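{- There is an infinite tournament $T\in\mathfrak{Out}_3\setminus\mathfrak{Out}_2$.
   Context: A tournament is a digraph $G=(V,E)$ such that for any two distinct $x,y\in V$ exactly one of $(x,y),(y,x)$ is in $E$. A set $A\subseteq V$ is independent if there is no edge (in either direction) between two distinct elements of $A$. For $n\in\mathbb N$, a digraph $G=(V,E)$ is in $\mathfrak{Out}_n$ iff there is an independent set $A\subseteq V$ such that for each $v\in V$ there is a directed path of length at most $n$ (length $0$ allowed) from some point of $A$ to $v$. -}

module Defs where

open import Data.Fin.Base using (Fin; zero; suc; fromℕ; inject₁)
open import Data.Nat.Base using (ℕ; suc; _≤_)
open import Data.Product.Base using (Σ-syntax; ∃-syntax; _×_)
open import Data.Sum.Base using (_⊎_)
open import Function.Bundles using (_↣_)
open import Function.Definitions using (Injective)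
open import Level using (0ℓ) renaming (suc to lsuc)
open import Relation.Binary.Core using (Rel)
open import Relation.Binary.PropositionalEquality.Core using (_≡_; _≢_)
open import Relation.Nullary.Negation.Core using (¬_)
open import Relation.Unary using (Pred; _∈_)

record Digraph : Set₁ where
  field
    V : Set
    E : Rel V 0ℓ

open Digraph public

IsTournament : Digraph → Set
IsTournament G = ∀ (x y : V G) → x ≢ y →
  (E G x y × ¬ E G y x) ⊎ (E G y x × ¬ E G x y)

-- Infinite in the positive sense: an injection of ℕ into the vertex set.
-- Classically this is the same as not being finite; constructively it is
-- the stronger of the two.
IsInfinite : Digraph → Set
IsInfinite G = ℕ ↣ V G

Independent : (G : Digraph) → Pred (V G) 0ℓ → Set
Independent G A = ∀ (x y : V G) → x ∈ A → y ∈ A → x ≢ y →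
  ¬ (E G x y ⊎ E G y x)

-- k counts edges, so a path has suc k vertices; they are pairwise distinct.
record DirectedPath (G : Digraph) (k : ℕ) (x y : V G) : Set where
  field
    vertex   : Fin (suc k) → V G
    distinct : Injective _≡_ _≡_ vertex
    source   : vertex zero ≡ x
    target   : vertex (fromℕ k) ≡ y
    edge     : ∀ (i : Fin k) → E G (vertex (inject₁ i)) (vertex (suc i))

Out : ℕ → Pred Digraph (lsuc 0ℓ)
Out n G = Σ[ A ∈ Pred (V G) 0ℓ ] (Independent G A ×
  (∀ (v : V G) → ∃[ a ] (a ∈ A × ∃[ k ] (k ≤ n × DirectedPath G k a v))))

{-# OPTIONS --safe #-}

-- Take a vertex r and three sequences aₙ, bₙ, cₙ. Each sequence is ordered by
-- n > m, the arcs between consecutive sequences go forward exactly when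
-- n ≥ m, every cₙ dominates every aₘ, and r dominates the aₙ only.
-- Then r → aₙ → bₙ → cₙ reaches every vertex in at most three steps.
-- An arc ending in some bₘ or cₘ never increases the index, and every arc
-- ending in cₘ starts in some bₖ or cₖ. So two steps from a vertex of index n
-- never lead to cₙ₊₁.
module Submission where

open import Defs
open import Data.Fin.Base using (zero; suc; toℕ)
open import Data.Fin.Properties using (toℕ-injective; toℕ-inject₁; toℕ-fromℕ; toℕ<n; toℕ≤pred[n])
open import Data.Nat.Base using (ℕ; suc; _≤_; _<_; z≤n; s≤s)
open import Data.Nat.Properties using (≤-refl; ≤-trans; <⇒≤; <⇒≱; <-asym; <-cmp; ≤-<-connex; <-≤-connex; 1+n≰n)
open import Data.Product.Base using (∃-syntax; _×_; _,_)
open import Data.Sum.Base using (_⊎_; inj₁; inj₂; map)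
open import Function.Base using (_∘_)
open import Function.Bundles using (mk↣)
open import Relation.Binary.Definitions using (tri<; tri≈; tri>)
open import Relation.Binary.PropositionalEquality using (_≡_; _≢_; refl; sym; trans; cong; subst)
open import Relation.Nullary.Negation using (¬_; contradiction)
open import Relation.Unary using (_∈_; _∉_; ｛_｝)

data Vertex : Set where
  r     : Vertex
  a b c : ℕ → Vertex

data Arc : Vertex → Vertex → Set where
  ra : ∀ {m} → Arc r (a m)
  br : ∀ {n} → Arc (b n) r
  cr : ∀ {n} → Arc (c n) r
  aa : ∀ {n m} → m < n → Arc (a n) (a m)
  bb : ∀ {n m} → m < n → Arc (b n) (b m)
  cc : ∀ {n m} → m < n → Arc (c n) (c m)
  ab : ∀ {n m} → m ≤ n → Arc (a n) (b m)
  ba : ∀ {n m} → m < n → Arc (b n) (a m)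
  bc : ∀ {n m} → m ≤ n → Arc (b n) (c m)
  cb : ∀ {n m} → m < n → Arc (c n) (b m)
  ca : ∀ {n m} → Arc (c n) (a m)

T : Digraph
T = record { V = Vertex ; E = Arc }

-- Between consecutive sequences one direction carries `≤` and the other its strict converse, so
-- equal indices cause no double arc. The remaining pairs of constructors clash on their endpoints.
Arc-asym : ∀ {x y} → Arc x y → ¬ Arc y x
Arc-asym (aa p) (aa q) = <-asym p q
Arc-asym (bb p) (bb q) = <-asym p q
Arc-asym (cc p) (cc q) = <-asym p q
Arc-asym (ab p) (ba q) = <⇒≱ q p
Arc-asym (ba p) (ab q) = <⇒≱ p q
Arc-asym (bc p) (cb q) = <⇒≱ q p
Arc-asym (cb p) (bc q) = <⇒≱ p q

distinct⇒comparable : (f : ℕ → Vertex) → (∀ {n m} → m < n → Arc (f n) (f m)) →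
  ∀ n m → f n ≢ f m → Arc (f n) (f m) ⊎ Arc (f m) (f n)
distinct⇒comparable f desc n m fn≢fm with <-cmp n m
... | tri< n<m _ _ = inj₂ (desc n<m)
... | tri≈ _ n≡m _ = contradiction (cong f n≡m) fn≢fm
... | tri> _ _ m<n = inj₁ (desc m<n)

Arc-connex : ∀ x y → x ≢ y → Arc x y ⊎ Arc y x
Arc-connex r     r     r≢r = contradiction refl r≢r
Arc-connex r     (a m) _   = inj₁ ra
Arc-connex r     (b m) _   = inj₂ br
Arc-connex r     (c m) _   = inj₂ cr
Arc-connex (a n) r     _   = inj₂ ra
Arc-connex (a n) (a m) x≢y = distinct⇒comparable a aa n m x≢y
Arc-connex (a n) (b m) _   = map ab ba (≤-<-connex m n)
Arc-connex (a n) (c m) _   = inj₂ ca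
Arc-connex (b n) r     _   = inj₁ br
Arc-connex (b n) (a m) _   = map ba ab (<-≤-connex m n)
Arc-connex (b n) (b m) x≢y = distinct⇒comparable b bb n m x≢y
Arc-connex (b n) (c m) _   = map bc cb (≤-<-connex m n)
Arc-connex (c n) r     _   = inj₁ cr
Arc-connex (c n) (a m) _   = inj₁ ca
Arc-connex (c n) (b m) _   = map cb bc (<-≤-connex m n)
Arc-connex (c n) (c m) x≢y = distinct⇒comparable c cc n m x≢y

T-isTournament : IsTournament T
T-isTournament x y x≢y with Arc-connex x y x≢y
... | inj₁ xy = inj₁ (xy , Arc-asym xy)
... | inj₂ yx = inj₂ (yx , Arc-asym yx)

T-isInfinite : IsInfinite T
T-isInfinite = mk↣ {to = c} λ { refl → refl }

-- Only the arguments j ≤ 3 matter; beyond them the value stays at c n.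
spine : ℕ → ℕ → Vertex
spine n 0                   = r
spine n 1                   = a n
spine n 2                   = b n
spine n (suc (suc (suc _))) = c n

-- Inverts `spine n` on arguments up to 3, which makes the vertices of a spine path distinct.
level : Vertex → ℕ
level r     = 0
level (a _) = 1
level (b _) = 2
level (c _) = 3

level-spine : ∀ n {j} → j ≤ 3 → level (spine n j) ≡ j
level-spine n {0} _ = refl
level-spine n {1} _ = refl
level-spine n {2} _ = refl
level-spine n {3} _ = refl
level-spine n {suc (suc (suc (suc _)))} (s≤s (s≤s (s≤s ())))

spine-arc : ∀ n {j} → j < 3 → Arc (spine n j) (spine n (suc j))
spine-arc n {0} _ = ra
spine-arc n {1} _ = ab ≤-refl
spine-arc n {2} _ = bc ≤-refl
spine-arc n {suc (suc (suc _))} (s≤s (s≤s (s≤s ())))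

spine-path : ∀ n {k} → k ≤ 3 → DirectedPath T k r (spine n k)
spine-path n {k} k≤3 = record
  { vertex   = spine n ∘ toℕ
  ; distinct = λ {i} {j} eq → toℕ-injective
      (trans (sym (level-toℕ i)) (trans (cong level eq) (level-toℕ j)))
  ; source   = refl
  ; target   = cong (spine n) (toℕ-fromℕ k)
  -- The arc starts at `inject₁ i`, whose value agrees with `toℕ i` only propositionally.
  ; edge     = λ i → subst (λ j → Arc (spine n j) (spine n (suc (toℕ i))))
      (sym (toℕ-inject₁ i)) (spine-arc n (≤-trans (toℕ<n i) k≤3))
  }
  where
  level-toℕ : ∀ i → level (spine n (toℕ i)) ≡ toℕ i
  level-toℕ i = level-spine n (≤-trans (toℕ≤pred[n] i) k≤3)

r-reaches : ∀ v → ∃[ k ] (k ≤ 3 × DirectedPath T k r v)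
r-reaches r     = 0 , z≤n , spine-path 0 z≤n
r-reaches (a n) = 1 , s≤s z≤n , spine-path n (s≤s z≤n)
r-reaches (b n) = 2 , s≤s (s≤s z≤n) , spine-path n (s≤s (s≤s z≤n))
r-reaches (c n) = 3 , ≤-refl , spine-path n ≤-refl

T∈Out3 : T ∈ Out 3
T∈Out3 = ｛ r ｝ , (λ { _ _ refl refl r≢r _ → r≢r refl }) , λ v → r , refl , r-reaches v

-- The 0 at `r` is a default: no arc leads from `r` to any `b m` or `c m`.
index : Vertex → ℕ
index r     = 0
index (a n) = n
index (b n) = n
index (c n) = n

-- The vertices `a m` are left out as targets because `ra` and `ca` can raise the index.
data IsBOrC : Vertex → Set where
  isB : ∀ {n} → IsBOrC (b n)
  isC : ∀ {n} → IsBOrC (c n)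

Arc-index : ∀ {x y} → IsBOrC y → Arc x y → index y ≤ index x
Arc-index isB (ab m≤n) = m≤n
Arc-index isB (bb m<n) = <⇒≤ m<n
Arc-index isB (cb m<n) = <⇒≤ m<n
Arc-index isC (bc m≤n) = m≤n
Arc-index isC (cc m<n) = <⇒≤ m<n

-- Makes `Arc-index` applicable to the first arc of a two-arc path into `c m`.
Arc-c-source : ∀ {x m} → Arc x (c m) → IsBOrC x
Arc-c-source (bc _) = isB
Arc-c-source (cc _) = isC

-- With three arcs the bound fails: `c n`, `a m`, `b m`, `c m` is a path for every m > n.
path-to-c-index : ∀ {k x m} → k ≤ 2 → DirectedPath T k x (c m) → m ≤ index x
path-to-c-index z≤n record { source = refl ; target = eq } =
  subst (λ v → _ ≤ index v) (sym eq) ≤-refl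
path-to-c-index (s≤s z≤n) record { source = refl ; target = eq ; edge = e } =
  Arc-index isC (subst (Arc _) eq (e zero))
path-to-c-index (s≤s (s≤s z≤n)) record { source = refl ; target = eq ; edge = e } =
  ≤-trans (Arc-index isC last) (Arc-index (Arc-c-source last) (e zero))
  where
  last = subst (Arc _) eq (e (suc zero))

-- Equality of vertices need not be decidable, hence the double negation; it suffices for refuting
-- membership in `Out 2`.
independent⇒¬distinct : ∀ {G A} → IsTournament G → Independent G A →
  ∀ {x y} → x ∈ A → y ∈ A → ¬ (x ≢ y)
independent⇒¬distinct tour ind {x} {y} x∈A y∈A x≢y with tour x y x≢y
... | inj₁ (xy , _) = ind x y x∈A y∈A x≢y (inj₁ xy)
... | inj₂ (yx , _) = ind x y x∈A y∈A x≢y (inj₂ yx)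

T∉Out2 : T ∉ Out 2
-- The choice of `r` is arbitrary; this only produces a point `x` of `A`.
T∉Out2 (A , ind , reach) with reach r
-- One index above `x` is out of its reach in two steps, so the point `y` reaching it would be a
-- second point of `A`.
... | x , x∈A , _ with reach (c (suc (index x)))
... | y , y∈A , _ , k≤2 , path =
  independent⇒¬distinct {A = A} T-isTournament ind x∈A y∈A
    λ { refl → 1+n≰n (path-to-c-index k≤2 path) }

theorem4p3 : ∃[ T ] (IsTournament T × IsInfinite T × T ∈ Out 3 × T ∉ Out 2)
theorem4p3 = T , T-isTournament , T-isInfinite , T∈Out3 , T∉Out2
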